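{- Fix an integer $k\ge 1$. Let $\chi_k^{\ast}(p,q)$ be the formal power series in $p$ satisfying $$1-(m-1)\chi_{k}^{\ast}(p,q)-pq\prod_{j=0}^{k-1}\chi_{k}^{\ast}(pq^j,q)-pq^2\bigl(m(u-1)+1\bigr)\prod_{j=0}^{k}\chi_{k}^{\ast}(pq^j,q)=0 .$$ Then $$\chi_{k}^{\ast}(p,q)=\sum_{n\ge 0}\frac{(-pq)^{n}}{(m-1)^{(k+1)n+1}}\sum_{\mu\in\mathtt{Dyck}(n;k)}\mathrm{wt}^{\ast}(\mu)\,q^{\mathrm{Area}(\mu)},$$ where $\mathrm{Area}(\mu)$ is the number of unit boxes below $\mu$ and above the lowest path $\mu_0=(UD^k)^n$.
   Context: The quantities $m,u,q$ are formal variables with $m-1$ invertible; $m'=m-1$ and $u'=u-1$. A $k$-Dyck path of size $n$ is a lattice path from $(0,0)$ to $(kn,n)$ consisting of up steps $U=(0,1)$ and down steps $D=(1,0)$ which never goes below the line $y=x/k$; $\mathtt{Dyck}(n;k)$ denotes the set of them, and $|\mu|$ denotes the size of $\mu$. The lowest path in $\mathtt{Dyck}(n;k)$ is $\mu_0=(UD^k)^n$. A $k$-Dyck path is prime if it is nonempty and touches the line $y=x/k$ only at its starting and ending points. Every nonempty $k$-Dyck path is uniquely a concatenation $\mu=\mu_1\circ\mu_2$ with $\mu_1$ prime and $\mu_2$ a (possibly empty) $k$-Dyck path. Every prime $k$-Dyck path is uniquely of the form $\mu_1=U\circ\lambda_1\circ D\circ\lambda_2\circ\cdots\circ D\circ\lambda_k\circ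 D$ with $\lambda_1,\ldots,\lambda_k$ (possibly empty) $k$-Dyck paths. The weight $\mathrm{wt}^{\ast}$ is defined recursively: $\mathrm{wt}^{\ast}((UD^k)^n)=(m'+q(m'u'+u'+1))^n$ (in particular $\mathrm{wt}^{\ast}(\emptyset)=1$); $\mathrm{wt}^{\ast}(\mu_1\circ\mu_2)=\mathrm{wt}^{\ast}(\mu_1)\,\mathrm{wt}^{\ast}(\mu_2)$ for $\mu_1$ prime; and for a prime path $\mu_1$ written as $\mu_1=U\circ\lambda_1\circ D\circ\lambda_2\circ\cdots\circ D\circ\lambda_k\circ D$, $$\mathrm{wt}^{\ast}(\mu_1)=\begin{cases} q(m'u'+u'+1)\prod_{i=1}^{k}q^{(k+1-i)|\lambda_i|}\mathrm{wt}^{\ast}(\lambda_i), & \lambda_1\ne\emptyset,\\ (m'+q(m'u'+u'+1))\prod_{i=2}^{k}q^{(k+1-i)|\lambda_i|}\mathrm{wt}^{\ast}(\lambda_i), & \lambda_1=\emptyset.\end{cases}$$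
   Formalization: The factors q^{(k+1-i)|λ_i|} are dropped from the recursion for wt*: they are already contained in q^{Area(μ)}, and with both the formula fails (k=1, coefficient of p^2: UUDD must contribute q^2 c a, not q^3 c a, where c=m(u-1)+1, a=m-1+qc). -}

module Defs where

open import Algebra.Bundles using (CommutativeRing)
open import Data.Fin.Base using (toℕ)
open import Data.List.Base as List using (List; []; _∷_; _++_; concat; replicate; filter; length; upTo; cartesianProduct)
open import Data.Nat.Base using (ℕ; zero; suc; _+_; _*_; _∸_; _≤_; _<_)
open import Data.Nat.Properties using (_≟_; _≤?_; _<?_)
open import Data.Product.Base using (_×_; _,_)
open import Data.Vec.Base as Vec using (Vec; []; _∷_; tabulate)
open import Relation.Binary.PropositionalEquality.Core using (_≡_)
open import Relation.Nullary.Decidable.Core using (Dec; _×-dec_)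

data Step : Set where
  U D : Step

Path : Set
Path = List Step

ups downs : Path → ℕ
ups []      = 0
ups (U ∷ μ) = suc (ups μ)
ups (D ∷ μ) = ups μ
downs []      = 0
downs (U ∷ μ) = downs μ
downs (D ∷ μ) = suc (downs μ)

-- The path μ started at (x , y) has no lattice point (x′ , y′) with y′ < x′ / k.
StaysAbove : (k x y : ℕ) → Path → Set
StaysAbove k x y []      = x ≤ k * y
StaysAbove k x y (U ∷ μ) = x ≤ k * y × StaysAbove k x (suc y) μ
StaysAbove k x y (D ∷ μ) = x ≤ k * y × StaysAbove k (suc x) y μ

IsDyck : (n k : ℕ) → Path → Set
IsDyck n k μ = downs μ ≡ k * n × ups μ ≡ n × StaysAbove k 0 0 μ

staysAbove? : ∀ k x y μ → Dec (StaysAbove k x y μ)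
staysAbove? k x y []      = x ≤? k * y
staysAbove? k x y (U ∷ μ) = (x ≤? k * y) ×-dec staysAbove? k x (suc y) μ
staysAbove? k x y (D ∷ μ) = (x ≤? k * y) ×-dec staysAbove? k (suc x) y μ

isDyck? : ∀ n k μ → Dec (IsDyck n k μ)
isDyck? n k μ = (downs μ ≟ k * n) ×-dec ((ups μ ≟ n) ×-dec staysAbove? k 0 0 μ)

-- All words of the given length, each exactly once.
words : ℕ → List Path
words zero    = [] ∷ []
words (suc l) = List.map (U ∷_) (words l) ++ List.map (D ∷_) (words l)

Dyck : (n k : ℕ) → List Path
Dyck n k = filter (isDyck? n k) (words (k * n + n))

lowest : (n k : ℕ) → Path
lowest n k = concat (replicate n (U ∷ replicate k D))

-- For a path started at height y: the height of its down step
-- from abscissa i to abscissa i + 1.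
level : (y : ℕ) → Path → ℕ → ℕ
level y []      i       = y
level y (U ∷ μ) i       = level (suc y) μ i
level y (D ∷ μ) zero    = y
level y (D ∷ μ) (suc i) = level y μ i

-- (i , j) stands for the unit box [i , i + 1] × [j , j + 1].
BoxBetween : (ν μ : Path) → ℕ × ℕ → Set
BoxBetween ν μ (i , j) = level 0 ν i ≤ j × j < level 0 μ i

boxBetween? : ∀ ν μ b → Dec (BoxBetween ν μ b)
boxBetween? ν μ (i , j) = (level 0 ν i ≤? j) ×-dec (j <? level 0 μ i)

Area : (k : ℕ) → Path → ℕ
Area k μ = length (filter (boxBetween? (lowest n k) μ)
                          (cartesianProduct (upTo (k * n)) (upTo n)))
  where n = ups μ

-- A k-Dyck path written through its unique decomposition: λs ∘ μ₂ stands for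
--   U λ₁ D λ₂ D … D λₖ D μ₂,  with prime first part U λ₁ D … D λₖ D.
data Decomposed (k : ℕ) : Set where
  ∅   : Decomposed k
  _∘_ : Vec (Decomposed k) k → Decomposed k → Decomposed k

-- Any word is uniquely f₀ D f₁ D … D fⱼ₋₁ D w′ with each fᵢ returning to its
-- starting height (U rises by k, D falls by 1) and never going below it, as long
-- as w descends that far; factor k w j is the decomposition of fⱼ, the longest
-- such prefix of w′.  If w = U w₁, then f₀ of w is U λ₁ D … D λₖ D μ₂, where
-- λ₁ , … , λₖ , μ₂ are the factors number 0 , … , k of w₁.
factor : ∀ k → Path → ℕ → Decomposed k
factor k []      j       = ∅
factor k (D ∷ w) zero    = ∅
factor k (D ∷ w) (suc j) = factor k w j
factor k (U ∷ w) zero    = tabulate (λ i → factor k w (toℕ i)) ∘ factor k w k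
factor k (U ∷ w) (suc j) = factor k w (k + suc j)

decompose : ∀ k → Path → Decomposed k
decompose k μ = factor k μ 0

module Weight {c ℓ} (R : CommutativeRing c ℓ) (m u q : CommutativeRing.Carrier R) where
  open CommutativeRing R using (Carrier; 1#; _-_) renaming (_+_ to _⊕_; _*_ to _⊗_)

  m′ u′ b a : Carrier
  m′ = m - 1#
  u′ = u - 1#
  b  = q ⊗ (m′ ⊗ u′ ⊕ u′ ⊕ 1#)
  a  = m′ ⊕ b

  -- Unlike the printed definition of this weight, the recursion carries no
  -- factors q ^ ((k + 1 - i) |λᵢ|).  Since
  --   Area (U λ₁ D … D λₖ D) = ∑ᵢ ((k + 1 - i) |λᵢ| + Area λᵢ),
  -- these powers are already contained in q ^ Area, by which the weight is
  -- multiplied in the expansion of χ.  With both, the expansion is false: for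
  -- k = 1, UUDD has to contribute q b a, not q² b a, to the coefficient of p².
  -- The value a ^ n at (U Dᵏ)ⁿ is a consequence of the recursion.
  mutual
    weight : ∀ {k} → Decomposed k → Carrier
    weight ∅        = 1#
    weight (λs ∘ μ) = primeWeight λs ⊗ weight μ

    primeWeight : ∀ {k l} → Vec (Decomposed k) l → Carrier
    primeWeight []                = 1#   -- only reached for k = 0
    primeWeight (∅ ∷ λs)          = a ⊗ weights λs
    primeWeight (λ₁@(_ ∘ _) ∷ λs) = b ⊗ weights (λ₁ ∷ λs)

    weights : ∀ {k l} → Vec (Decomposed k) l → Carrier
    weights []        = 1#
    weights (λ₁ ∷ λs) = weight λ₁ ⊗ weights λs

  wt* : (k : ℕ) → Path → Carrier
  wt* k μ = weight (decompose k μ)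

module PowerSeries {c ℓ} (R : CommutativeRing c ℓ) where
  open CommutativeRing R using (Carrier; _≈_; 0#; 1#; _-_; semiring; +-rawMonoid)
    renaming (_+_ to _⊕_; _*_ to _⊗_)
  open import Algebra.Properties.Semiring.Exp semiring public using (_^_)
  open import Algebra.Definitions.RawMonoid +-rawMonoid using (sum)

  infix  4 _≈ₛ_
  infixl 6 _-ₛ_
  infixl 7 _*ₛ_ _·ₛ_

  -- f n is the coefficient of p ^ n.
  Series : Set c
  Series = ℕ → Carrier

  _≈ₛ_ : Series → Series → Set ℓ
  f ≈ₛ g = ∀ n → f n ≈ g n

  0ₛ 1ₛ : Series
  0ₛ n       = 0#
  1ₛ zero    = 1#
  1ₛ (suc n) = 0#

  _-ₛ_ _*ₛ_ : Series → Series → Series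
  (f -ₛ g) n = f n - g n
  (f *ₛ g) n = sum {suc n} (λ i → f (toℕ i) ⊗ g (n ∸ toℕ i))

  _·ₛ_ : Carrier → Series → Series
  (x ·ₛ f) n = x ⊗ f n

  p*_ : Series → Series
  (p* f) zero    = 0#
  (p* f) (suc n) = f n

  -- f (p x)
  _[p_] : Series → Carrier → Series
  (f [p x ]) n = x ^ n ⊗ f n

  ∏[j<_] : ℕ → (ℕ → Series) → Series
  ∏[j< zero  ] F = 1ₛ
  ∏[j< suc l ] F = ∏[j< l ] F *ₛ F l

  sumOver : ∀ {A : Set} → List A → (A → Carrier) → Carrier
  sumOver xs f = List.foldr (λ x s → f x ⊕ s) 0# xs

{-# OPTIONS --safe #-}

-- Under the recursion, wt* μ is the product over the up steps of μ of b or a,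
-- according to whether the next step is up or down.  Counting the boxes between
-- μ and the lowest path by rows, Area μ is the sum of the heights at which the up
-- steps start, where U rises by k and D falls by 1.  Hence the words leading from
-- height j - 1 to height 0 have generating functions Eⱼ(t) with E₀ = 1 and
--   Eⱼ₊₁ = Eⱼ + t q ʲ (m′ Eⱼ₊ₖ + b Eⱼ₊ₖ₊₁).
-- Multiplying the functional equation at p q ʲ by Xⱼ = χ(p) χ(p q) ⋯ χ(p q ʲ⁻¹)
-- gives
--   m′ Xⱼ₊₁ = Xⱼ - p q q ʲ (Xⱼ₊ₖ + b Xⱼ₊ₖ₊₁),
-- the same recursion up to the scaling Xⱼ = m′ ⁻ʲ Eⱼ (- p q / m′ ᵏ⁺¹); it determines
-- all coefficients, and j = 1 is the expansion of χ.
module Submission where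

open import Defs
open import Algebra.Bundles using (CommutativeRing)
import Algebra.Properties.CommutativeSemigroup as CommutativeSemigroupProperties
import Algebra.Properties.CommutativeSemiring.Exp as CommutativeExpProperties
import Algebra.Properties.Ring as RingProperties
import Algebra.Properties.Semiring.Exp as ExpProperties
import Algebra.Properties.Semiring.Sum as SumProperties
import Algebra.Solver.Ring.NaturalCoefficients.Default as SemiringSolver
open import Data.Bool.Base using (true; false)
open import Data.Fin.Base using (toℕ)
open import Data.Fin.Properties using (toℕ≤pred[n])
open import Data.List.Base as List using (List; []; _∷_; _++_; applyUpTo; cartesianProduct; filter; length; replicate; upTo)
open import Data.List.Properties using (filter-++; filter-accept; filter-reject; length-++)
open import Data.Nat.Base as ℕ using (ℕ; zero; suc; pred; z≤n; s≤s; s≤s⁻¹; NonZero)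
open import Data.Nat.ListAction using (sum)
import Data.Nat.Properties as ℕ
import Data.Nat.Tactic.RingSolver as ℕ-Solver
open import Data.Product.Base using (_×_; _,_; proj₁; proj₂)
open import Data.Vec.Base using (tabulate)
open import Function.Base using (_∘′_; id)
open import Level using (Level)
open import Relation.Binary.Bundles using (Setoid)
open import Relation.Binary.PropositionalEquality as ≡ using (_≡_)
import Relation.Binary.Reasoning.Setoid as SetoidReasoning
open import Relation.Nullary using (¬_; Dec; does; yes; no; contradiction)
open import Relation.Nullary.Decidable using (_×-dec_)
open import Relation.Unary using (Pred; Decidable)

-- Area as the sum of the starting heights of the up steps.

module DyckPathArea where
  open import Data.Nat.Base using (_+_; _*_; _∸_; _⊔_; _≤_; _<_)
  open import Data.Nat.Properties
  open import Data.Nat.Tactic.RingSolver using (solve-∀)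
  open import Relation.Binary.PropositionalEquality using (refl; sym; trans; cong; cong₂; subst; module ≡-Reasoning)
  open CommutativeSemigroupProperties +-commutativeSemigroup using ()
    renaming (interchange to +-interchange; x∙yz≈y∙xz to +-x∙yz≈y∙xz)

  private variable
    k j n : ℕ
    w : Path

  -- Measuring heights so that U rises by k and D falls by 1: the words with n
  -- up steps that lead from height j to height 0 through heights ≥ 0.
  data Descends (k : ℕ) : (j n : ℕ) → Path → Set where
    end  : Descends k 0 0 []
    up   : Descends k (k + j) n w → Descends k j (suc n) (U ∷ w)
    down : Descends k j n w → Descends k (suc j) n (D ∷ w)

  upHeights : (k j : ℕ) → Path → ℕ
  upHeights k j []      = 0
  upHeights k j (U ∷ w) = j + upHeights k (k + j) w
  -- At height 0 `pred` gives a default value; words satisfying `Descends` have no down step there.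
  upHeights k j (D ∷ w) = upHeights k (pred j) w

  levelSum : ℕ → Path → ℕ
  levelSum y w = sum (applyUpTo (level y w) (downs w))

  descends-downs : Descends k j n w → downs w ≡ k * n + j
  descends-downs {k} end = sym (trans (+-identityʳ _) (*-zeroʳ k))
  descends-downs {k} {j} {suc n} (up d) = trans (descends-downs d) (lemma k n j)
    where
    lemma : ∀ k n j → k * n + (k + j) ≡ k * suc n + j
    lemma = solve-∀
  descends-downs {k} {suc j} {n} (down d) =
    trans (cong suc (descends-downs d)) (sym (+-suc (k * n) j))

  descends-ups : Descends k j n w → ups w ≡ n
  descends-ups end      = refl
  descends-ups (up d)   = cong suc (descends-ups d)
  descends-ups (down d) = descends-ups d

  private
    rise : ∀ k x y {j} → x + j ≡ k * y → x + (k + j) ≡ k * suc y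
    rise k x y {j} e = begin
      x + (k + j)  ≡⟨ +-x∙yz≈y∙xz x k j ⟩
      k + (x + j)  ≡⟨ cong (k +_) e ⟩
      k + k * y    ≡⟨ *-suc k y ⟨
      k * suc y    ∎
      where
      open ≡-Reasoning

  -- The equation `x + j ≡ k * y` expresses the height `j` at the point (x , y) as k y - x without
  -- subtraction, so `x ≤ k * y` amounts to j ≥ 0.
  descends-staysAbove : ∀ {x y} → x + j ≡ k * y → Descends k j n w → StaysAbove k x y w
  descends-staysAbove {x = x} e end = ≤-trans (m≤m+n x _) (≤-reflexive e)
  descends-staysAbove {k = k} {x = x} {y} e (up d) =
    ≤-trans (m≤m+n x _) (≤-reflexive e) , descends-staysAbove (rise k x y e) d
  descends-staysAbove {x = x} e (down d) =
    ≤-trans (m≤m+n x _) (≤-reflexive e) , descends-staysAbove (trans (sym (+-suc x _)) e) d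

  staysAbove-start : ∀ {x y} w → StaysAbove k x y w → x ≤ k * y
  staysAbove-start []      s = s
  staysAbove-start (U ∷ w) s = proj₁ s
  staysAbove-start (D ∷ w) s = proj₁ s

  -- The numbers of letters force the final height to be 0, and the line condition excludes a down
  -- step from height 0.
  staysAbove-descends : ∀ {x y} w → x + j ≡ k * y → downs w ≡ k * n + j → ups w ≡ n →
                        StaysAbove k x y w → Descends k j n w
  staysAbove-descends {j = zero} [] e _ refl s = end
  staysAbove-descends {j = suc j} {k = k} [] e ds refl s with () ← trans ds (+-suc _ j)
  staysAbove-descends {j = j} {k = k} {x = x} {y} (U ∷ w) e ds refl (_ , s) =
    up (staysAbove-descends w (rise k x y e) (trans ds (lemma k (ups w) j)) refl s)
    where
    lemma : ∀ k n j → k * suc n + j ≡ k * n + (k + j)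
    lemma = solve-∀
  staysAbove-descends {j = zero} (D ∷ w) e ds us (_ , s) =
    -- Height 0 means x = k y, so the point after this down step has abscissa x + 1 > k y.
    contradiction (staysAbove-start w s) (<⇒≱ (s≤s (≤-reflexive (trans (sym e) (+-identityʳ _)))))
  staysAbove-descends {j = suc j} {x = x} (D ∷ w) e ds us (_ , s) =
    down (staysAbove-descends w (trans (sym (+-suc x j)) e) (suc-injective (trans ds (+-suc _ j))) us s)

  dyck⇒descends : IsDyck n k w → Descends k 0 n w
  dyck⇒descends {n} {k} {w} (ds , us , s) =
    staysAbove-descends w (sym (*-zeroʳ k)) (trans ds (sym (+-identityʳ _))) us s

  descends⇒dyck : Descends k 0 n w → IsDyck n k w
  descends⇒dyck {k} d =
    trans (descends-downs d) (+-identityʳ _) , descends-ups d , descends-staysAbove (sym (*-zeroʳ k)) d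

  -- The prefix of `l` down steps is the unfinished part of a block U Dᵏ; without it the induction
  -- could not pass through a block.
  lowest-descends : ∀ k n l → Descends k l n (replicate l D ++ lowest n k)
  lowest-descends k zero    zero    = end
  lowest-descends k (suc n) zero    =
    up (subst (λ i → Descends k i n (replicate k D ++ lowest n k)) (sym (+-identityʳ k)) (lowest-descends k n k))
  lowest-descends k n       (suc l) = down (lowest-descends k n l)

  lowest-upHeights : ∀ k n l → upHeights k l (replicate l D ++ lowest n k) ≡ 0
  lowest-upHeights k zero    zero    = refl
  lowest-upHeights k (suc n) zero    =
    trans (cong (λ i → upHeights k i (replicate k D ++ lowest n k)) (+-identityʳ k)) (lowest-upHeights k n k)
  lowest-upHeights k n       (suc l) = lowest-upHeights k n l

  -- The height before the down step at abscissa `i` is l + k (level - y) - i. It is at most `k`,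
  -- because each up step of the lowest path starts at height 0.
  lowest-level : ∀ k n {l} → l ≤ k → ∀ y i → k * level y (replicate l D ++ lowest n k) i + l ≤ k * y + k + i
  lowest-level k zero {zero} _ y i =
    ≤-trans (≤-reflexive (+-identityʳ _)) (≤-trans (m≤m+n (k * y) k) (m≤m+n _ i))
  lowest-level k (suc n) {zero} _ y i = begin
    k * lv + 0      ≡⟨ +-identityʳ _ ⟩
    k * lv          ≤⟨ +-cancelʳ-≤ k _ _ (≤-trans (lowest-level k n ≤-refl (suc y) i) (≤-reflexive (lemma k y i))) ⟩
    k * y + k + i   ∎
    where
    open ≤-Reasoning
    lv = level (suc y) (replicate k D ++ lowest n k) i
    lemma : ∀ k y i → k * suc y + k + i ≡ k * y + k + i + k
    lemma = solve-∀
  lowest-level k n {suc l} l<k y zero =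
    ≤-trans (+-monoʳ-≤ (k * y) l<k) (m≤m+n _ 0)
  lowest-level k n {suc l} l<k y (suc i) = begin
    k * lv + suc l         ≡⟨ +-suc _ l ⟩
    suc (k * lv + l)       ≤⟨ s≤s (lowest-level k n (<⇒≤ l<k) y i) ⟩
    suc (k * y + k + i)    ≡⟨ +-suc _ i ⟨
    k * y + k + suc i      ∎
    where
    open ≤-Reasoning
    lv = level y (replicate l D ++ lowest n k) i

  level≤ups : ∀ y w i → level y w i ≤ y + ups w
  level≤ups y []      i       = m≤m+n y 0
  level≤ups y (U ∷ w) i       = ≤-trans (level≤ups (suc y) w i) (≤-reflexive (sym (+-suc y (ups w))))
  level≤ups y (D ∷ w) zero    = m≤m+n y (ups w)
  level≤ups y (D ∷ w) (suc i) = level≤ups y w i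

  -- A down step starts at height at least 1, and that height is j + k (level - y) - i.
  descends-level : Descends k j n w → ∀ y {i} → i < downs w → k * y + i < k * level y w i + j
  descends-level {k} {j} {w = U ∷ w} (up d) y {i} i< = +-cancelˡ-< k _ _ (begin-strict
    k + (k * y + i)      ≡⟨ lemma₁ k y i ⟩
    k * suc y + i        <⟨ descends-level d (suc y) i< ⟩
    k * lv + (k + j)     ≡⟨ lemma₂ k j lv ⟩
    k + (k * lv + j)     ∎)
    where
    open ≤-Reasoning
    lv = level (suc y) w i
    lemma₁ : ∀ k y i → k + (k * y + i) ≡ k * suc y + i
    lemma₁ = solve-∀
    lemma₂ : ∀ k j l → k * l + (k + j) ≡ k + (k * l + j)
    lemma₂ = solve-∀
  descends-level {k} (down d) y {zero} i< = +-monoʳ-< (k * y) (s≤s z≤n)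
  descends-level {k} {suc j} {w = D ∷ w} (down d) y {suc i} (s≤s i<) = begin-strict
    k * y + suc i                ≡⟨ +-suc (k * y) i ⟩
    suc (k * y + i)              <⟨ s≤s (descends-level d y i<) ⟩
    suc (k * level y w i + j)    ≡⟨ +-suc _ j ⟨
    k * level y w i + suc j      ∎
    where open ≤-Reasoning

  -- Before the down step at abscissa `i` the lowest path has height at most k and `w` has height at
  -- least 1. Hence k lo ≤ k + i < k + k hi, so lo < hi + 1.
  lowest≤descends : .{{NonZero k}} → Descends k 0 n w → ∀ {i} → i < downs w →
                    level 0 (lowest n k) i ≤ level 0 w i
  lowest≤descends {k} {n} {w} d {i} i< = s≤s⁻¹ (*-cancelˡ-< k _ _ (begin-strict
    k * lo                ≡⟨ +-identityʳ _ ⟨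
    k * lo + 0            ≤⟨ lowest-level k n z≤n 0 i ⟩
    k * 0 + k + i         ≡⟨ lemma k i ⟩
    k + (k * 0 + i)       <⟨ +-monoʳ-< k (descends-level d 0 i<) ⟩
    k + (k * hi + 0)      ≡⟨ cong (k +_) (+-identityʳ _) ⟩
    k + k * hi            ≡⟨ *-suc k hi ⟨
    k * suc hi            ∎))
    where
    open ≤-Reasoning
    lo = level 0 (lowest n k) i
    hi = level 0 w i
    lemma : ∀ k i → k * 0 + k + i ≡ k + (k * 0 + i)
    lemma = solve-∀

  -- k times (y + 1) + … + (y + n) is the level sum of (U Dᵏ)ⁿ started at height y.
  rises : ℕ → ℕ → ℕ
  rises y zero    = 0
  rises y (suc n) = suc y + rises (suc y) n

  -- The boxes below a path and above the line y = x / k are here counted by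
  -- columns on the left and by rows on the right, up to a constant.
  levelSum-upHeights : Descends k j n w → ∀ y → levelSum y w ≡ upHeights k j w + (j * y + k * rises y n)
  levelSum-upHeights {k} end y = sym (*-zeroʳ k)
  levelSum-upHeights {k} {j} {suc n} {U ∷ w} (up d) y =
    trans (levelSum-upHeights d (suc y)) (lemma k j y (upHeights k (k + j) w) (rises (suc y) n))
    where
    lemma : ∀ k j y h r → h + ((k + j) * suc y + k * r) ≡ j + h + (j * y + k * (suc y + r))
    lemma = solve-∀
  levelSum-upHeights {k} {suc j} {n} {D ∷ w} (down d) y =
    trans (cong (y +_) (levelSum-upHeights d y)) (lemma y (upHeights k j w) (j * y) (k * rises y n))
    where
    lemma : ∀ y h s r → y + (h + (s + r)) ≡ h + ((y + s) + r)
    lemma = solve-∀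

  length-filter-map : ∀ {a b p} {A : Set a} {B : Set b} {P : Pred B p} (P? : Decidable P) (f : A → B) xs →
                      length (filter P? (List.map f xs)) ≡ length (filter (λ x → P? (f x)) xs)
  length-filter-map P? f []       = refl
  length-filter-map P? f (x ∷ xs) with does (P? (f x))
  ... | false = length-filter-map P? f xs
  ... | true  = cong suc (length-filter-map P? f xs)

  -- Counts boxes column by column. `upTo` is generalised to `applyUpTo f`, whose tail is
  -- `applyUpTo (f ∘′ suc)`.
  length-filter-cartesianProduct :
    ∀ {b p} {B : Set b} {P : Pred (ℕ × B) p} (P? : Decidable P) (f : ℕ → ℕ) n (ys : List B) →
    length (filter P? (cartesianProduct (applyUpTo f n) ys)) ≡
    sum (applyUpTo (λ i → length (filter (λ y → P? (f i , y)) ys)) n)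
  length-filter-cartesianProduct P? f zero    ys = refl
  length-filter-cartesianProduct P? f (suc n) ys = begin
    length (filter P? (row ++ rows))                        ≡⟨ cong length (filter-++ P? row rows) ⟩
    length (filter P? row ++ filter P? rows)                ≡⟨ length-++ (filter P? row) ⟩
    length (filter P? row) + length (filter P? rows)        ≡⟨ cong₂ _+_ (length-filter-map P? (f 0 ,_) ys)
                                                                  (length-filter-cartesianProduct P? (f ∘′ suc) n ys) ⟩
    _                                                       ∎
    where
    open ≡-Reasoning
    row  = List.map (f 0 ,_) ys
    rows = cartesianProduct (applyUpTo (f ∘′ suc) n) ys

  -- The list runs through s , ... , s + n - 1. The start `s` varies because each induction step
  -- moves it up by one; `f` is known only pointwise because it becomes `f ∘′ suc`.
  length-filter-interval :
    ∀ lo hi s n (f : ℕ → ℕ) → (∀ i → f i ≡ s + i) → hi ≤ s + n →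
    length (filter (λ j → (lo ≤? j) ×-dec (j <? hi)) (applyUpTo f n)) ≡ hi ∸ (lo ⊔ s)
  length-filter-interval lo hi s zero f f≡ hi≤ =
    sym (m≤n⇒m∸n≡0 (≤-trans hi≤ (≤-trans (≤-reflexive (+-identityʳ s)) (m≤n⊔m lo s))))
  length-filter-interval lo hi s (suc n) f f≡ hi≤ = cases (lo ≤? s) (s <? hi)
    where
    in? : Decidable (λ j → lo ≤ j × j < hi)
    in? j = (lo ≤? j) ×-dec (j <? hi)
    f0≡s : f 0 ≡ s
    f0≡s = trans (f≡ 0) (+-identityʳ s)
    rest : length (filter in? (applyUpTo (f ∘′ suc) n)) ≡ hi ∸ (lo ⊔ suc s)
    rest = length-filter-interval lo hi (suc s) n (f ∘′ suc)
             (λ i → trans (f≡ (suc i)) (+-suc s i)) (≤-trans hi≤ (≤-reflexive (+-suc s n)))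
    reject : ¬ (lo ≤ s × s < hi) → length (filter in? (applyUpTo f (suc n))) ≡ hi ∸ (lo ⊔ suc s)
    reject out = trans (cong length (filter-reject in? (out ∘′ subst (λ j → lo ≤ j × j < hi) f0≡s))) rest
    cases : Dec (lo ≤ s) → Dec (s < hi) → length (filter in? (applyUpTo f (suc n))) ≡ hi ∸ (lo ⊔ s)
    cases (no lo≰s) _ = trans (reject (lo≰s ∘′ proj₁)) (cong (hi ∸_)
      (trans (m≥n⇒m⊔n≡m (≰⇒> lo≰s)) (sym (m≥n⇒m⊔n≡m (<⇒≤ (≰⇒> lo≰s))))))
    cases (yes lo≤s) (no s≮hi) = trans (reject (s≮hi ∘′ proj₂))
      (trans (m≤n⇒m∸n≡0 (≤-trans (≮⇒≥ s≮hi) (≤-trans (n≤1+n s) (m≤n⊔m lo (suc s)))))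
             (sym (m≤n⇒m∸n≡0 (≤-trans (≮⇒≥ s≮hi) (m≤n⊔m lo s)))))
    cases (yes lo≤s) (yes s<hi) = begin
      length (filter in? (applyUpTo f (suc n)))
        ≡⟨ cong length (filter-accept in? (subst (λ j → lo ≤ j × j < hi) (sym f0≡s) (lo≤s , s<hi))) ⟩
      suc (length (filter in? (applyUpTo (f ∘′ suc) n)))    ≡⟨ cong suc rest ⟩
      suc (hi ∸ (lo ⊔ suc s))    ≡⟨ cong (λ l → suc (hi ∸ l)) (m≤n⇒m⊔n≡n (≤-trans lo≤s (n≤1+n s))) ⟩
      suc (hi ∸ suc s)           ≡⟨ +-∸-assoc 1 s<hi ⟨
      hi ∸ s                     ≡⟨ cong (hi ∸_) (m≤n⇒m⊔n≡n lo≤s) ⟨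
      hi ∸ (lo ⊔ s)              ∎
      where open ≡-Reasoning

  sum-∸-+ : ∀ (f g : ℕ → ℕ) n → (∀ {i} → i < n → f i ≤ g i) →
            sum (applyUpTo (λ i → g i ∸ f i) n) + sum (applyUpTo f n) ≡ sum (applyUpTo g n)
  sum-∸-+ f g zero    f≤g = refl
  sum-∸-+ f g (suc n) f≤g = begin
    (g 0 ∸ f 0 + rest) + (f 0 + sum (applyUpTo (f ∘′ suc) n))    ≡⟨ +-interchange (g 0 ∸ f 0) rest (f 0) _ ⟩
    (g 0 ∸ f 0 + f 0) + (rest + sum (applyUpTo (f ∘′ suc) n))    ≡⟨ cong₂ _+_ (m∸n+n≡m (f≤g (s≤s z≤n)))
                                                                     (sum-∸-+ (f ∘′ suc) (g ∘′ suc) n (λ i< → f≤g (s≤s i<))) ⟩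
    g 0 + sum (applyUpTo (g ∘′ suc) n)                          ∎
    where
    open ≡-Reasoning
    rest = sum (applyUpTo (λ i → g (suc i) ∸ f (suc i)) n)

  sum-applyUpTo-cong : ∀ {f g : ℕ → ℕ} n → (∀ i → f i ≡ g i) → sum (applyUpTo f n) ≡ sum (applyUpTo g n)
  sum-applyUpTo-cong zero    f≗g = refl
  sum-applyUpTo-cong (suc n) f≗g = cong₂ _+_ (f≗g 0) (sum-applyUpTo-cong n (λ i → f≗g (suc i)))

  Area≡columns : ∀ k w → Area k w ≡ sum (applyUpTo (λ i → level 0 w i ∸ level 0 (lowest (ups w) k) i) (k * ups w))
  Area≡columns k w =
    trans (length-filter-cartesianProduct (boxBetween? (lowest (ups w) k) w) id (k * ups w) (upTo (ups w)))
          (sum-applyUpTo-cong (k * ups w) λ i →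
            -- By `level≤ups` the rows 0 , ... , ups w - 1 reach the top of every column, so no box
            -- is cut off.
            trans (length-filter-interval _ _ 0 (ups w) id (λ _ → refl) (level≤ups 0 w i))
                  (cong (level 0 w i ∸_) (⊔-identityʳ (level 0 (lowest (ups w) k) i))))

  -- The area is the difference of the level sums of `w` and of the lowest path. By
  -- `levelSum-upHeights` both contain the same `k * rises 0 n`, and all up steps of the lowest path
  -- start at height 0.
  Area≡upHeights : .{{NonZero k}} → Descends k 0 n w → Area k w ≡ upHeights k 0 w
  Area≡upHeights {k} {n} {w} d = +-cancelʳ-≡ (levelSum 0 (lowest n k)) _ _ (begin
    Area k w + levelSum 0 (lowest n k)                ≡⟨ cong (_+ levelSum 0 (lowest n k)) (Area≡columns k w) ⟩
    sum (applyUpTo (λ i → level 0 w i ∸ level 0 (lowest (ups w) k) i) (k * ups w)) + levelSum 0 (lowest n k)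
      ≡⟨ cong₂ (λ u l → sum (applyUpTo (λ i → level 0 w i ∸ level 0 (lowest u k) i) (k * u))
                        + sum (applyUpTo (level 0 (lowest n k)) l))
               (descends-ups d) (descends-downs-0 lowest-d) ⟩
    sum (applyUpTo (λ i → level 0 w i ∸ level 0 (lowest n k) i) (k * n))
      + sum (applyUpTo (level 0 (lowest n k)) (k * n))
      ≡⟨ sum-∸-+ (level 0 (lowest n k)) (level 0 w) (k * n)
           (λ i< → lowest≤descends d (≤-trans i< (≤-reflexive (sym (descends-downs-0 d))))) ⟩
    sum (applyUpTo (level 0 w) (k * n))               ≡⟨ cong (sum ∘′ applyUpTo (level 0 w)) (descends-downs-0 d) ⟨
    levelSum 0 w                                      ≡⟨ levelSum-upHeights d 0 ⟩
    upHeights k 0 w + k * rises 0 n                   ≡⟨ cong (upHeights k 0 w +_) lowest-levelSum ⟨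
    upHeights k 0 w + levelSum 0 (lowest n k)         ∎)
    where
    open ≡-Reasoning
    lowest-d : Descends k 0 n (lowest n k)
    lowest-d = lowest-descends k n 0
    descends-downs-0 : ∀ {w} → Descends k 0 n w → downs w ≡ k * n
    descends-downs-0 d = trans (descends-downs d) (+-identityʳ _)
    lowest-levelSum : levelSum 0 (lowest n k) ≡ k * rises 0 n
    lowest-levelSum = trans (levelSum-upHeights lowest-d 0) (cong (_+ k * rises 0 n) (lowest-upHeights k n 0))

open DyckPathArea

-- Power series, q-shifted products and the functional equation.

module SeriesProperties {c ℓ} (R : CommutativeRing c ℓ) where
  open CommutativeRing R hiding (zero)
  open PowerSeries R
  open SumProperties semiring using (sum; sum-cong-≋; ∑-distrib-+; *-distribˡ-sum)
  open ExpProperties semiring using (^-homo-*; ^-congʳ; ^-congˡ)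
  open CommutativeExpProperties commutativeSemiring using (^-distrib-*)
  open CommutativeSemigroupProperties *-commutativeSemigroup using (interchange; x∙yz≈y∙xz)
  open SemiringSolver commutativeSemiring using (solve; con; _:=_; _:+_; _:*_)
  module ≈ = SetoidReasoning setoid

  infixl 6 _+ₛ_

  _+ₛ_ : Series → Series → Series
  (f +ₛ g) n = f n + g n

  -- `(f *ₛ g) (suc n)` unfolds definitionally to `f 0 * g (suc n) + (tail f *ₛ g) n`, which drives
  -- the inductions on coefficients.
  tail : Series → Series
  tail f n = f (suc n)

  seriesSetoid : Setoid c ℓ
  seriesSetoid = record
    { Carrier       = Series
    ; _≈_           = _≈ₛ_
    ; isEquivalence = record
      { refl  = λ n → refl
      ; sym   = λ f≈g n → sym (f≈g n)
      ; trans = λ f≈g g≈h n → trans (f≈g n) (g≈h n)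
      }
    }

  module ≈ₛ = SetoidReasoning seriesSetoid
  open Setoid seriesSetoid using () renaming (refl to ≈ₛ-refl; sym to ≈ₛ-sym; trans to ≈ₛ-trans)

  +ₛ-cong : ∀ {f f′ g g′} → f ≈ₛ f′ → g ≈ₛ g′ → f +ₛ g ≈ₛ f′ +ₛ g′
  +ₛ-cong f≈ g≈ n = +-cong (f≈ n) (g≈ n)

  ·ₛ-cong : ∀ x {f g} → f ≈ₛ g → x ·ₛ f ≈ₛ x ·ₛ g
  ·ₛ-cong x f≈g n = *-congˡ (f≈g n)

  p*-cong : ∀ {f g} → f ≈ₛ g → p* f ≈ₛ p* g
  p*-cong f≈g zero    = refl
  p*-cong f≈g (suc n) = f≈g n

  *ₛ-cong : ∀ {f f′ g g′} → f ≈ₛ f′ → g ≈ₛ g′ → f *ₛ g ≈ₛ f′ *ₛ g′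
  *ₛ-cong f≈ g≈ n = sum-cong-≋ {suc n} (λ i → *-cong (f≈ (toℕ i)) (g≈ (n ℕ.∸ toℕ i)))

  *ₛ-congˡ : ∀ f {g g′} → g ≈ₛ g′ → f *ₛ g ≈ₛ f *ₛ g′
  *ₛ-congˡ f = *ₛ-cong {f} ≈ₛ-refl

  *ₛ-distribʳ-+ₛ : ∀ h f g → (f +ₛ g) *ₛ h ≈ₛ f *ₛ h +ₛ g *ₛ h
  *ₛ-distribʳ-+ₛ h f g n = trans
    (sum-cong-≋ {suc n} (λ i → distribʳ (h (n ℕ.∸ toℕ i)) (f (toℕ i)) (g (toℕ i))))
    (∑-distrib-+ {suc n} (λ i → f (toℕ i) * h (n ℕ.∸ toℕ i)) (λ i → g (toℕ i) * h (n ℕ.∸ toℕ i)))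

  *ₛ-distribˡ-+ₛ : ∀ h f g → h *ₛ (f +ₛ g) ≈ₛ h *ₛ f +ₛ h *ₛ g
  *ₛ-distribˡ-+ₛ h f g n = trans
    (sum-cong-≋ {suc n} (λ i → distribˡ (h (toℕ i)) (f (n ℕ.∸ toℕ i)) (g (n ℕ.∸ toℕ i))))
    (∑-distrib-+ {suc n} (λ i → h (toℕ i) * f (n ℕ.∸ toℕ i)) (λ i → h (toℕ i) * g (n ℕ.∸ toℕ i)))

  ·ₛ-*ₛ-assoc : ∀ x f g → (x ·ₛ f) *ₛ g ≈ₛ x ·ₛ (f *ₛ g)
  ·ₛ-*ₛ-assoc x f g n = trans
    (sum-cong-≋ {suc n} (λ i → *-assoc x (f (toℕ i)) (g (n ℕ.∸ toℕ i))))
    (sym (*-distribˡ-sum {suc n} x (λ i → f (toℕ i) * g (n ℕ.∸ toℕ i))))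

  *ₛ-·ₛ-comm : ∀ x f g → f *ₛ (x ·ₛ g) ≈ₛ x ·ₛ (f *ₛ g)
  *ₛ-·ₛ-comm x f g n = trans
    (sum-cong-≋ {suc n} (λ i → x∙yz≈y∙xz (f (toℕ i)) x (g (n ℕ.∸ toℕ i))))
    (sym (*-distribˡ-sum {suc n} x (λ i → f (toℕ i) * g (n ℕ.∸ toℕ i))))

  *ₛ-zeroˡ : ∀ f → 0ₛ *ₛ f ≈ₛ 0ₛ
  *ₛ-zeroˡ f zero    = trans (+-identityʳ _) (zeroˡ (f 0))
  *ₛ-zeroˡ f (suc n) = trans (+-cong (zeroˡ (f (suc n))) (*ₛ-zeroˡ f n)) (+-identityʳ 0#)

  *ₛ-identityˡ : ∀ f → 1ₛ *ₛ f ≈ₛ f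
  *ₛ-identityˡ f zero    = trans (+-identityʳ _) (*-identityˡ (f 0))
  *ₛ-identityˡ f (suc n) = trans (+-cong (*-identityˡ (f (suc n))) (*ₛ-zeroˡ f n)) (+-identityʳ _)

  *ₛ-identityʳ : ∀ f → f *ₛ 1ₛ ≈ₛ f
  *ₛ-identityʳ f zero    = trans (+-identityʳ _) (*-identityʳ (f 0))
  *ₛ-identityʳ f (suc n) = trans (+-cong (zeroʳ (f 0)) (*ₛ-identityʳ (tail f) n)) (+-identityˡ _)

  *ₛ-p* : ∀ f g → f *ₛ (p* g) ≈ₛ p* (f *ₛ g)
  *ₛ-p* f g zero          = trans (+-identityʳ _) (zeroʳ (f 0))
  -- The cases 1 and n + 2 are separated so that `p*` reduces in the induction hypothesis: to `0#`
  -- in the first, to a coefficient of `tail f *ₛ g` in the second.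
  *ₛ-p* f g (suc zero)    = +-congˡ (*ₛ-p* (tail f) g zero)
  *ₛ-p* f g (suc (suc n)) = +-congˡ (*ₛ-p* (tail f) g (suc n))

  -- Induction on the coefficient, since `tail (f *ₛ g)` is `f 0 ·ₛ tail g +ₛ tail f *ₛ g`.
  *ₛ-assoc : ∀ f g h → (f *ₛ g) *ₛ h ≈ₛ f *ₛ (g *ₛ h)
  *ₛ-assoc f g h zero    =
    solve 3 (λ x y z → (x :* y :+ con 0) :* z :+ con 0 := x :* (y :* z :+ con 0) :+ con 0) refl (f 0) (g 0) (h 0)
  *ₛ-assoc f g h (suc n) = begin
    (f *ₛ g) 0 * h (suc n) + (tail (f *ₛ g) *ₛ h) n
      ≈⟨ +-cong (*-congʳ (+-identityʳ _)) (begin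
           (tail (f *ₛ g) *ₛ h) n                            ≈⟨ *ₛ-distribʳ-+ₛ h (f 0 ·ₛ tail g) (tail f *ₛ g) n ⟩
           ((f 0 ·ₛ tail g) *ₛ h) n + ((tail f *ₛ g) *ₛ h) n   ≈⟨ +-cong (·ₛ-*ₛ-assoc (f 0) (tail g) h n) (*ₛ-assoc (tail f) g h n) ⟩
           f 0 * (tail g *ₛ h) n + (tail f *ₛ (g *ₛ h)) n      ∎) ⟩
    f 0 * g 0 * h (suc n) + (f 0 * (tail g *ₛ h) n + (tail f *ₛ (g *ₛ h)) n)
      ≈⟨ solve 5 (λ x y z s t → x :* y :* z :+ (x :* s :+ t) := x :* (y :* z :+ s) :+ t) refl
           (f 0) (g 0) (h (suc n)) _ _ ⟩
    f 0 * (g *ₛ h) (suc n) + (tail f *ₛ (g *ₛ h)) n  ∎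
    where open ≈

  [p]-cong : ∀ x {f g} → f ≈ₛ g → f [p x ] ≈ₛ g [p x ]
  [p]-cong x f≈g n = *-congˡ (f≈g n)

  [p]-arg : ∀ f {x y} → x ≈ y → f [p x ] ≈ₛ f [p y ]
  [p]-arg f x≈y n = *-congʳ (^-congˡ n x≈y)

  [p]-[p] : ∀ f x y → f [p x ] [p y ] ≈ₛ f [p y * x ]
  [p]-[p] f x y n = trans (sym (*-assoc _ _ _)) (*-congʳ (sym (^-distrib-* y x n)))

  [p1] : ∀ f → f [p 1# ] ≈ₛ f
  [p1] f n = trans (*-congʳ (1^ n)) (*-identityˡ (f n))
    where
    1^ : ∀ n → 1# ^ n ≈ 1#
    1^ zero    = refl
    1^ (suc n) = trans (*-identityˡ _) (1^ n)

  1ₛ-[p] : ∀ x → 1ₛ [p x ] ≈ₛ 1ₛ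
  1ₛ-[p] x zero    = *-identityˡ 1#
  1ₛ-[p] x (suc n) = zeroʳ _

  +ₛ-[p] : ∀ x f g → (f +ₛ g) [p x ] ≈ₛ f [p x ] +ₛ g [p x ]
  +ₛ-[p] x f g n = distribˡ (x ^ n) (f n) (g n)

  ·ₛ-[p] : ∀ x y f → (y ·ₛ f) [p x ] ≈ₛ y ·ₛ (f [p x ])
  ·ₛ-[p] x y f n = x∙yz≈y∙xz (x ^ n) y (f n)

  p*-[p] : ∀ x f → (p* f) [p x ] ≈ₛ x ·ₛ p* (f [p x ])
  p*-[p] x f zero    = trans (zeroʳ _) (sym (zeroʳ _))
  p*-[p] x f (suc n) = *-assoc x (x ^ n) (f n)

  *ₛ-[p] : ∀ x f g → (f *ₛ g) [p x ] ≈ₛ f [p x ] *ₛ g [p x ]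
  *ₛ-[p] x f g n = trans
    (*-distribˡ-sum {suc n} (x ^ n) (λ i → f (toℕ i) * g (n ℕ.∸ toℕ i)))
    (sum-cong-≋ {suc n} λ i → begin
      x ^ n * (f (toℕ i) * g (n ℕ.∸ toℕ i))
        ≈⟨ *-congʳ (^-congʳ x (ℕ.m+[n∸m]≡n (toℕ≤pred[n] i))) ⟨
      x ^ (toℕ i ℕ.+ (n ℕ.∸ toℕ i)) * (f (toℕ i) * g (n ℕ.∸ toℕ i))
        ≈⟨ *-congʳ (^-homo-* x (toℕ i) (n ℕ.∸ toℕ i)) ⟩
      x ^ toℕ i * x ^ (n ℕ.∸ toℕ i) * (f (toℕ i) * g (n ℕ.∸ toℕ i))
        ≈⟨ interchange _ _ _ _ ⟩
      (f [p x ]) (toℕ i) * (g [p x ]) (n ℕ.∸ toℕ i)  ∎)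
    where open ≈

  -- The product Xⱼ, with `l` in the role of j.
  qProduct : Carrier → Series → ℕ → Series
  qProduct q χ l = ∏[j< l ] (λ j → χ [p q ^ j ])

  -- Substituting p q ʲ for p turns the factors 0 , ... , l - 1 into the factors j , ... , l + j -
  -- 1.
  qProduct-+ : ∀ q χ j l → qProduct q χ j *ₛ qProduct q χ l [p q ^ j ] ≈ₛ qProduct q χ (l ℕ.+ j)
  qProduct-+ q χ j zero    = ≈ₛ-trans (*ₛ-congˡ (qProduct q χ j) (1ₛ-[p] (q ^ j))) (*ₛ-identityʳ _)
  qProduct-+ q χ j (suc l) = begin
    Π j *ₛ (Π l *ₛ χ [p q ^ l ]) [p q ^ j ]
      ≈⟨ *ₛ-congˡ (Π j) (*ₛ-[p] (q ^ j) (Π l) (χ [p q ^ l ])) ⟩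
    Π j *ₛ (Π l [p q ^ j ] *ₛ χ [p q ^ l ] [p q ^ j ])
      ≈⟨ *ₛ-assoc (Π j) (Π l [p q ^ j ]) (χ [p q ^ l ] [p q ^ j ]) ⟨
    Π j *ₛ Π l [p q ^ j ] *ₛ χ [p q ^ l ] [p q ^ j ]
      ≈⟨ *ₛ-cong (qProduct-+ q χ j l) (≈ₛ-trans ([p]-[p] χ (q ^ l) (q ^ j)) ([p]-arg χ power)) ⟩
    Π (l ℕ.+ j) *ₛ χ [p q ^ (l ℕ.+ j) ]  ∎
    where
    open ≈ₛ
    Π = qProduct q χ
    power : q ^ j * q ^ l ≈ q ^ (l ℕ.+ j)
    power = trans (*-comm _ _) (sym (^-homo-* q l j))

  -- The functional equation at p q ʲ, multiplied by χ(p) χ(p q) ⋯ χ(p q ʲ⁻¹).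
  qProduct-step : ∀ q χ k v x y →
    1ₛ ≈ₛ v ·ₛ χ +ₛ p* (x ·ₛ qProduct q χ k) +ₛ p* (y ·ₛ qProduct q χ (suc k)) →
    ∀ j n → qProduct q χ j n ≈ (v ·ₛ qProduct q χ (suc j) +ₛ q ^ j ·ₛ p* (x ·ₛ qProduct q χ (k ℕ.+ j))
                             +ₛ q ^ j ·ₛ p* (y ·ₛ qProduct q χ (suc k ℕ.+ j))) n
  qProduct-step q χ k v x y eq j = begin
    Π j                       ≈⟨ *ₛ-identityʳ (Π j) ⟨
    Π j *ₛ 1ₛ                 ≈⟨ *ₛ-congˡ (Π j) (≈ₛ-trans (≈ₛ-sym (1ₛ-[p] Q)) ([p]-cong Q eq)) ⟩
    Π j *ₛ (F +ₛ G +ₛ H) [p Q ]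
      ≈⟨ *ₛ-congˡ (Π j) (≈ₛ-trans (+ₛ-[p] Q (F +ₛ G) H) (+ₛ-cong (+ₛ-[p] Q F G) (≈ₛ-refl {H [p Q ]}))) ⟩
    Π j *ₛ (F [p Q ] +ₛ G [p Q ] +ₛ H [p Q ])
      ≈⟨ ≈ₛ-trans (*ₛ-distribˡ-+ₛ (Π j) (F [p Q ] +ₛ G [p Q ]) (H [p Q ]))
                  (+ₛ-cong (*ₛ-distribˡ-+ₛ (Π j) (F [p Q ]) (G [p Q ])) (≈ₛ-refl {Π j *ₛ H [p Q ]})) ⟩
    Π j *ₛ F [p Q ] +ₛ Π j *ₛ G [p Q ] +ₛ Π j *ₛ H [p Q ]
      ≈⟨ +ₛ-cong (+ₛ-cong (≈ₛ-trans (*ₛ-congˡ (Π j) (·ₛ-[p] Q v χ)) (*ₛ-·ₛ-comm v (Π j) (χ [p Q ])))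
                          (shifted x k)) (shifted y (suc k)) ⟩
    v ·ₛ Π (suc j) +ₛ Q ·ₛ p* (x ·ₛ Π (k ℕ.+ j)) +ₛ Q ·ₛ p* (y ·ₛ Π (suc k ℕ.+ j))  ∎
    where
    open ≈ₛ
    Π = qProduct q χ
    Q = q ^ j
    F = v ·ₛ χ
    G = p* (x ·ₛ Π k)
    H = p* (y ·ₛ Π (suc k))
    -- The factor `Q` appears because the substitution turns the leading p into p q ʲ.
    shifted : ∀ z l → Π j *ₛ (p* (z ·ₛ Π l)) [p Q ] ≈ₛ Q ·ₛ p* (z ·ₛ Π (l ℕ.+ j))
    shifted z l = begin
      Π j *ₛ (p* (z ·ₛ Π l)) [p Q ]         ≈⟨ *ₛ-congˡ (Π j) (p*-[p] Q (z ·ₛ Π l)) ⟩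
      Π j *ₛ (Q ·ₛ p* ((z ·ₛ Π l) [p Q ]))  ≈⟨ *ₛ-·ₛ-comm Q (Π j) (p* ((z ·ₛ Π l) [p Q ])) ⟩
      Q ·ₛ (Π j *ₛ p* ((z ·ₛ Π l) [p Q ]))  ≈⟨ ·ₛ-cong Q (*ₛ-p* (Π j) ((z ·ₛ Π l) [p Q ])) ⟩
      Q ·ₛ p* (Π j *ₛ (z ·ₛ Π l) [p Q ])    ≈⟨ ·ₛ-cong Q (p*-cong (begin
        Π j *ₛ (z ·ₛ Π l) [p Q ]              ≈⟨ *ₛ-congˡ (Π j) (·ₛ-[p] Q z (Π l)) ⟩
        Π j *ₛ (z ·ₛ (Π l [p Q ]))            ≈⟨ *ₛ-·ₛ-comm z (Π j) (Π l [p Q ]) ⟩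
        z ·ₛ (Π j *ₛ Π l [p Q ])              ≈⟨ ·ₛ-cong z (qProduct-+ q χ j l) ⟩
        z ·ₛ Π (l ℕ.+ j)                      ∎)) ⟩
      Q ·ₛ p* (z ·ₛ Π (l ℕ.+ j))            ∎

  -- Both families satisfy the same recursion up to scaling. The induction is on `n` first and on
  -- `j` inside: the larger indices k + j and k + 1 + j occur only at the preceding coefficient.
  expansion-from-recursion :
    ∀ q b v v⁻¹ k χ → v * v⁻¹ ≈ 1# →
    1ₛ ≈ₛ v ·ₛ χ +ₛ p* (q ·ₛ qProduct q χ k) +ₛ p* ((q * b) ·ₛ qProduct q χ (suc k)) →
    (E : ℕ → Series) → E 0 ≈ₛ 1ₛ → (∀ j → E (suc j) 0 ≈ E j 0) →
    (∀ j n → E (suc j) (suc n) ≈ E j (suc n) + q ^ j * (v * E (k ℕ.+ j) n + b * E (suc k ℕ.+ j) n)) →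
    ∀ n j → qProduct q χ j n ≈ (- q) ^ n * (v⁻¹ ^ suc k) ^ n * v⁻¹ ^ j * E j n
  expansion-from-recursion q b v c k χ vc≈1 eq E E₀ E-zero E-suc = coefficient
    where
    open ≈
    Π = qProduct q χ
    C = c ^ suc k
    step = qProduct-step q χ k v q (q * b) eq

    -- The common summand `y` avoids moving the shifted terms across the equation, so the semiring
    -- solver never meets a subtraction.
    v-cancel : ∀ {x x′ y} → v * x + y ≈ v * x′ + y → x ≈ x′
    v-cancel {x} {x′} {y} e = begin
      x              ≈⟨ *-identityˡ x ⟨
      1# * x         ≈⟨ *-congʳ cv≈1 ⟨
      c * v * x      ≈⟨ *-assoc c v x ⟩
      c * (v * x)    ≈⟨ *-congˡ (+-cancelʳ y _ _ e) ⟩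
      c * (v * x′)   ≈⟨ *-assoc c v x′ ⟨
      c * v * x′     ≈⟨ *-congʳ cv≈1 ⟩
      1# * x′        ≈⟨ *-identityˡ x′ ⟩
      x′             ∎
      where
      open RingProperties ring using (+-cancelʳ)
      cv≈1 : c * v ≈ 1#
      cv≈1 = trans (*-comm c v) vc≈1

    coefficient : ∀ n j → Π j n ≈ (- q) ^ n * C ^ n * c ^ j * E j n
    coefficient zero zero = trans (sym (E₀ 0))
      (sym (trans (*-congʳ (trans (*-identityʳ _) (*-identityʳ 1#))) (*-identityˡ _)))
    coefficient (suc n) zero = sym (trans (*-congˡ (E₀ (suc n))) (zeroʳ _))
    coefficient zero (suc j) = v-cancel (begin
      v * Π (suc j) 0 + (Q * 0# + Q * 0#)    ≈⟨ +-assoc _ _ _ ⟨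
      v * Π (suc j) 0 + Q * 0# + Q * 0#      ≈⟨ step j 0 ⟨
      Π j 0                                  ≈⟨ coefficient zero j ⟩
      1# * 1# * c ^ j * E j 0                ≈⟨ *-identityˡ _ ⟨
      1# * (1# * 1# * c ^ j * E j 0)         ≈⟨ *-cong (sym vc≈1) (*-congˡ (sym (E-zero j))) ⟩
      v * c * (1# * 1# * c ^ j * E (suc j) 0)
        ≈⟨ solve 5 (λ v c d e Q → v :* c :* (con 1 :* con 1 :* d :* e)
                       := v :* (con 1 :* con 1 :* (c :* d) :* e) :+ (Q :* con 0 :+ Q :* con 0))
             refl v c (c ^ j) (E (suc j) 0) Q ⟩
      v * (1# * 1# * c ^ suc j * E (suc j) 0) + (Q * 0# + Q * 0#)  ∎)
      where Q = q ^ j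
    coefficient (suc n) (suc j) = v-cancel (begin
      v * Π (suc j) (suc n) + (Q * (q * Π (k ℕ.+ j) n) + Q * (q * b * Π (suc k ℕ.+ j) n))
        ≈⟨ +-assoc _ _ _ ⟨
      v * Π (suc j) (suc n) + Q * (q * Π (k ℕ.+ j) n) + Q * (q * b * Π (suc k ℕ.+ j) n)
        ≈⟨ step j (suc n) ⟨
      Π j (suc n)                                       ≈⟨ coefficient (suc n) j ⟩
      r * rⁿ * (c * K * Cⁿ) * cʲ * E j (suc n)          ≈⟨ +-identityʳ _ ⟨
      -- To the solver `r` is an atom, so r + q = 0 enters by hand, multiplied by `W`: here q W is
      -- `Y`, while r W supplies the two new terms of `E-suc`.
      r * rⁿ * (c * K * Cⁿ) * cʲ * E j (suc n) + 0#     ≈⟨ +-congˡ (trans (*-congʳ (-‿inverseˡ q)) (zeroˡ _)) ⟨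
      r * rⁿ * (c * K * Cⁿ) * cʲ * E j (suc n) + (r + q) * W
        ≈⟨ solve 12 (λ q b c r rⁿ K Cⁿ cʲ Q E₁ E₂ E₃ →
             r :* rⁿ :* (c :* K :* Cⁿ) :* cʲ :* E₁
               :+ (r :+ q) :* (Q :* rⁿ :* Cⁿ :* K :* cʲ :* (E₂ :+ b :* c :* E₃))
             := con 1 :* (con 1 :* (r :* rⁿ :* Cⁿ :* K :* cʲ :* Q :* E₂)
                          :+ r :* rⁿ :* (c :* K :* Cⁿ) :* cʲ :* (E₁ :+ Q :* b :* E₃))
                :+ (Q :* (q :* (rⁿ :* Cⁿ :* (K :* cʲ) :* E₂))
                :+ Q :* (q :* b :* (rⁿ :* Cⁿ :* (c :* (K :* cʲ)) :* E₃))))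
           refl q b c r rⁿ K Cⁿ cʲ Q (E j (suc n)) (E (k ℕ.+ j) n) (E (suc k ℕ.+ j) n) ⟩
      1# * (1# * (r * rⁿ * Cⁿ * K * cʲ * Q * E (k ℕ.+ j) n)
            + r * rⁿ * (c * K * Cⁿ) * cʲ * (E j (suc n) + Q * b * E (suc k ℕ.+ j) n)) + Y
        -- The units split off before become v c: the outer one yields the `v` to be cancelled and
        -- the additional `c` of `c ^ suc j`, the inner one the `v` before `E (k ℕ.+ j) n` and the
        -- `c` missing from `C ^ suc n`.
        ≈⟨ +-congʳ (*-cong (sym vc≈1) (+-congʳ (*-congʳ (sym vc≈1)))) ⟩
      v * c * (v * c * (r * rⁿ * Cⁿ * K * cʲ * Q * E (k ℕ.+ j) n)
            + r * rⁿ * (c * K * Cⁿ) * cʲ * (E j (suc n) + Q * b * E (suc k ℕ.+ j) n)) + Y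
        ≈⟨ +-congʳ (solve 12 (λ v b c r rⁿ K Cⁿ cʲ Q E₁ E₂ E₃ →
             v :* c :* (v :* c :* (r :* rⁿ :* Cⁿ :* K :* cʲ :* Q :* E₂)
                        :+ r :* rⁿ :* (c :* K :* Cⁿ) :* cʲ :* (E₁ :+ Q :* b :* E₃))
             := v :* (r :* rⁿ :* (c :* K :* Cⁿ) :* (c :* cʲ) :* (E₁ :+ Q :* (v :* E₂ :+ b :* E₃))))
           refl v b c r rⁿ K Cⁿ cʲ Q (E j (suc n)) (E (k ℕ.+ j) n) (E (suc k ℕ.+ j) n)) ⟩
      v * (r * rⁿ * (c * K * Cⁿ) * (c * cʲ) * (E j (suc n) + Q * (v * E (k ℕ.+ j) n + b * E (suc k ℕ.+ j) n))) + Y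
        ≈⟨ +-cong (*-congˡ (*-congˡ (sym (E-suc j n))))
                  (+-cong (*-congˡ (*-congˡ (sym (previous (k ℕ.+ j) k+j))))
                          (*-congˡ (*-congˡ (sym (previous (suc k ℕ.+ j) (*-congˡ k+j)))))) ⟩
      v * (r ^ suc n * C ^ suc n * c ^ suc j * E (suc j) (suc n))
        + (Q * (q * Π (k ℕ.+ j) n) + Q * (q * b * Π (suc k ℕ.+ j) n))  ∎)
      where
      Q = q ^ j
      r = - q
      rⁿ = r ^ n
      K = c ^ k
      Cⁿ = C ^ n
      cʲ = c ^ j
      W = Q * rⁿ * Cⁿ * K * cʲ * (E (k ℕ.+ j) n + b * c * E (suc k ℕ.+ j) n)
      Y = Q * (q * (rⁿ * Cⁿ * (K * cʲ) * E (k ℕ.+ j) n))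
        + Q * (q * b * (rⁿ * Cⁿ * (c * (K * cʲ)) * E (suc k ℕ.+ j) n))
      k+j : c ^ (k ℕ.+ j) ≈ K * cʲ
      k+j = ^-homo-* c k j
      previous : ∀ i {d} → c ^ i ≈ d → Π i n ≈ rⁿ * Cⁿ * d * E i n
      previous i e = trans (coefficient n i) (*-congʳ (*-congˡ e))

-- Finite sums over lists of words.

module SumOverProperties {c ℓ} (R : CommutativeRing c ℓ) where
  open CommutativeRing R hiding (zero)
  open PowerSeries R using (sumOver)

  private variable
    A B : Set

  sumOver-++ : ∀ (xs ys : List A) f → sumOver (xs ++ ys) f ≈ sumOver xs f + sumOver ys f
  sumOver-++ []       ys f = sym (+-identityˡ _)
  sumOver-++ (x ∷ xs) ys f = trans (+-congˡ (sumOver-++ xs ys f)) (sym (+-assoc _ _ _))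

  sumOver-map : ∀ (g : A → B) xs f → sumOver (List.map g xs) f ≡ sumOver xs (f ∘′ g)
  sumOver-map g []       f = ≡.refl
  sumOver-map g (x ∷ xs) f = ≡.cong (f (g x) +_) (sumOver-map g xs f)

  sumOver-zero : ∀ (xs : List A) → sumOver xs (λ _ → 0#) ≈ 0#
  sumOver-zero []       = refl
  sumOver-zero (x ∷ xs) = trans (+-identityˡ _) (sumOver-zero xs)

  *-distribˡ-sumOver : ∀ y (xs : List A) f → sumOver xs (λ x → y * f x) ≈ y * sumOver xs f
  *-distribˡ-sumOver y []       f = sym (zeroʳ y)
  *-distribˡ-sumOver y (x ∷ xs) f = trans (+-congˡ (*-distribˡ-sumOver y xs f)) (sym (distribˡ _ _ _))

  -- Trades the Dyck condition for a summand that vanishes off Dyck words; a sum over all words can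
  -- then be split by first letter.
  sumOver-filter : ∀ {p} {P : Pred A p} (P? : Decidable P) xs {f g} →
                   (∀ {x} → P x → f x ≈ g x) → (∀ {x} → ¬ P x → g x ≈ 0#) →
                   sumOver (filter P? xs) f ≈ sumOver xs g
  sumOver-filter P? []       f≈g g≈0 = refl
  sumOver-filter P? (x ∷ xs) f≈g g≈0 with P? x
  ... | yes px = +-cong (f≈g px) (sumOver-filter P? xs f≈g g≈0)
  ... | no ¬px = trans (sumOver-filter P? xs f≈g g≈0) (sym (trans (+-congʳ (g≈0 ¬px)) (+-identityˡ _)))

  sumOver-words : ∀ l f → sumOver (words (suc l)) f ≈
                  sumOver (words l) (λ w → f (U ∷ w)) + sumOver (words l) (λ w → f (D ∷ w))
  sumOver-words l f = trans (sumOver-++ (List.map (U ∷_) (words l)) (List.map (D ∷_) (words l)) f)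
    (+-cong (reflexive (sumOver-map (U ∷_) (words l) f)) (reflexive (sumOver-map (D ∷_) (words l) f)))

-- The weight as a product over up steps, and the recursion for path generating functions.

module PathWeight {c ℓ} (R : CommutativeRing c ℓ) (m u q : CommutativeRing.Carrier R) (k : ℕ) where
  open CommutativeRing R hiding (zero)
  open PowerSeries R using (_^_; sumOver; Series; 1ₛ)
  open Weight R m u q
  open SumOverProperties R
  open ExpProperties semiring using (^-homo-*)
  open SemiringSolver commutativeSemiring using (solve; con; _:=_; _:+_; _:*_)
  module ≈ = SetoidReasoning setoid

  -- The paths are `K`-Dyck paths. The successor form exposes λ₁, whose emptiness decides between
  -- `a` and `b`.
  K : ℕ
  K = suc k

  upWeight : Path → Carrier
  -- This agrees with `factor`, which gives `∅` on the empty word; a word ending in U never reaches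
  -- height 0.
  upWeight []      = a
  upWeight (U ∷ _) = b
  upWeight (D ∷ _) = a

  -- In terms of its steps, wt* μ q ^ Area μ is a product over the up steps;
  -- words that do not lead from height j to height 0 with n up steps get 0.
  stepWeight : Path → (j n : ℕ) → Carrier
  stepWeight []      zero    zero    = 1#
  stepWeight []      zero    (suc n) = 0#
  stepWeight []      (suc j) n       = 0#
  stepWeight (U ∷ w) j       zero    = 0#
  stepWeight (U ∷ w) j       (suc n) = upWeight w * (q ^ j * stepWeight w (K ℕ.+ j) n)
  stepWeight (D ∷ w) zero    n       = 0#
  stepWeight (D ∷ w) (suc j) n       = stepWeight w j n

  ¬descends⇒stepWeight≈0 : ∀ w j n → ¬ Descends K j n w → stepWeight w j n ≈ 0#
  ¬descends⇒stepWeight≈0 []      zero    zero    ¬d = contradiction end ¬d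
  ¬descends⇒stepWeight≈0 []      zero    (suc n) ¬d = refl
  ¬descends⇒stepWeight≈0 []      (suc j) n       ¬d = refl
  ¬descends⇒stepWeight≈0 (U ∷ w) j       zero    ¬d = refl
  ¬descends⇒stepWeight≈0 (U ∷ w) j       (suc n) ¬d =
    trans (*-congˡ (trans (*-congˡ (¬descends⇒stepWeight≈0 w (K ℕ.+ j) n (¬d ∘′ up))) (zeroʳ _))) (zeroʳ _)
  ¬descends⇒stepWeight≈0 (D ∷ w) zero    n       ¬d = refl
  ¬descends⇒stepWeight≈0 (D ∷ w) (suc j) n       ¬d = ¬descends⇒stepWeight≈0 w j n (¬d ∘′ down)

  weights-tabulate-+ : ∀ {k} (g : ℕ → Decomposed k) i l →
    weights (tabulate {n = i ℕ.+ l} (λ x → g (toℕ x))) ≈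
    weights (tabulate {n = i} (λ x → g (toℕ x))) * weights (tabulate {n = l} (λ x → g (i ℕ.+ toℕ x)))
  weights-tabulate-+ g zero    l = sym (*-identityˡ _)
  weights-tabulate-+ g (suc i) l =
    trans (*-congˡ (weights-tabulate-+ (g ∘′ suc) i l)) (sym (*-assoc _ _ _))

  factorsWeight : Path → ℕ → Carrier
  factorsWeight w i = weights (tabulate {n = i} (λ x → factor K w (toℕ x)))

  -- λ₁ is `factor K w 0`, which is nonempty exactly when `w` starts with U.
  primeWeight-factors : ∀ w → primeWeight (tabulate {n = K} (λ x → factor K w (toℕ x))) ≈ upWeight w * factorsWeight w K
  primeWeight-factors []      = *-congˡ (sym (*-identityˡ _))
  primeWeight-factors (U ∷ w) = refl
  primeWeight-factors (D ∷ w) = *-congˡ (sym (*-identityˡ _))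

  -- A word from height j to 0 is f₀ D f₁ ... D fⱼ, hence j + 1 factors. After an up step, the first
  -- `K` factors of the rest are λ₁ , ... , λₖ, the next is μ₂, and the last j are f₁ , ... , fⱼ.
  descends⇒stepWeight : ∀ {j n w} → Descends K j n w →
    stepWeight w j n ≈ factorsWeight w (suc j) * q ^ upHeights K j w
  descends⇒stepWeight end = sym (trans (*-identityʳ _) (*-identityʳ 1#))
  descends⇒stepWeight (down d) = trans (descends⇒stepWeight d) (*-congʳ (sym (*-identityˡ _)))
  descends⇒stepWeight {j} {suc n} {U ∷ w} (up d) = begin
    upWeight w * (q ^ j * stepWeight w (K ℕ.+ j) n)
      ≈⟨ *-congˡ (*-congˡ (trans (descends⇒stepWeight d) (*-congʳ split))) ⟩
    upWeight w * (q ^ j * (factorsWeight w K * (weight (factor K w K) * rest) * q ^ h))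
      ≈⟨ solve 6 (λ s x f y z t → s :* (x :* (f :* (y :* z) :* t)) := s :* f :* y :* z :* (x :* t)) refl
           (upWeight w) (q ^ j) (factorsWeight w K) (weight (factor K w K)) rest (q ^ h) ⟩
    upWeight w * factorsWeight w K * weight (factor K w K) * rest * (q ^ j * q ^ h)
      ≈⟨ *-cong (*-congʳ (*-congʳ (primeWeight-factors w))) (^-homo-* q j h) ⟨
    factorsWeight (U ∷ w) (suc j) * q ^ upHeights K j (U ∷ w)  ∎
    where
    open ≈
    h = upHeights K (K ℕ.+ j) w
    rest = weights (tabulate {n = j} (λ x → factor K w (K ℕ.+ suc (toℕ x))))
    split : factorsWeight w (suc (K ℕ.+ j)) ≈ factorsWeight w K * (weight (factor K w K) * rest)
    split = begin
      factorsWeight w (suc (K ℕ.+ j))    ≡⟨ ≡.cong (factorsWeight w) (ℕ.+-suc K j) ⟨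
      factorsWeight w (K ℕ.+ suc j)      ≈⟨ weights-tabulate-+ (factor K w) K (suc j) ⟩
      factorsWeight w K * (weight (factor K w (K ℕ.+ 0)) * rest)
        ≡⟨ ≡.cong (λ i → factorsWeight w K * (weight (factor K w i) * rest)) (ℕ.+-identityʳ K) ⟩
      factorsWeight w K * (weight (factor K w K) * rest)  ∎

  dyckSum : ℕ → Carrier
  dyckSum n = sumOver (Dyck n K) (λ μ → wt* K μ * q ^ Area K μ)

  -- Keeping the length `l` separate permits splitting off a letter; all words from height j with n
  -- up steps have l = K n + n + j.
  wordSum : (j n l : ℕ) → Carrier
  wordSum j n l = sumOver (words l) (λ w → stepWeight w j n)

  dyckSum≈wordSum : ∀ n → dyckSum n ≈ wordSum 0 n (K ℕ.* n ℕ.+ n)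
  dyckSum≈wordSum n = sumOver-filter (isDyck? n K) (words (K ℕ.* n ℕ.+ n))
    (λ {μ} dyck → let d = dyck⇒descends dyck in sym (begin
      stepWeight μ 0 n                         ≈⟨ descends⇒stepWeight d ⟩
      wt* K μ * 1# * q ^ upHeights K 0 μ       ≈⟨ *-congʳ (*-identityʳ _) ⟩
      wt* K μ * q ^ upHeights K 0 μ            ≡⟨ ≡.cong (λ s → wt* K μ * q ^ s) (Area≡upHeights d) ⟨
      wt* K μ * q ^ Area K μ                   ∎))
    (λ {μ} ¬dyck → ¬descends⇒stepWeight≈0 μ 0 n (¬dyck ∘′ descends⇒dyck))
    where open ≈

  -- Without up steps only Dʲ contributes, with weight 1.
  wordSum-level : ∀ j → wordSum j 0 j ≈ 1#
  wordSum-level zero    = +-identityʳ 1#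
  wordSum-level (suc j) = begin
    wordSum (suc j) 0 (suc j)      ≈⟨ sumOver-words j (λ w → stepWeight w (suc j) 0) ⟩
    sumOver (words j) (λ _ → 0#) + wordSum j 0 j    ≈⟨ +-cong (sumOver-zero (words j)) (wordSum-level j) ⟩
    0# + 1#                        ≈⟨ +-identityˡ 1# ⟩
    1#                             ∎
    where open ≈

  -- By a = m′ + b, all words contribute with factor b, those that start with D also with m′.
  wordSum-up-suc : ∀ j n i l →
    sumOver (words (suc l)) (λ w → upWeight w * (q ^ j * stepWeight w (suc i) n)) ≈
    q ^ j * (m′ * wordSum i n l + b * wordSum (suc i) n (suc l))
  wordSum-up-suc j n i l = begin
    sumOver (words (suc l)) (λ w → upWeight w * (q ^ j * stepWeight w (suc i) n))
      ≈⟨ sumOver-words l (λ w → upWeight w * (q ^ j * stepWeight w (suc i) n)) ⟩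
    sumOver (words l) (λ w → b * (q ^ j * stepWeight (U ∷ w) (suc i) n))
      + sumOver (words l) (λ w → a * (q ^ j * stepWeight w i n))
      ≈⟨ +-cong (scale b (λ w → stepWeight (U ∷ w) (suc i) n)) (scale a (λ w → stepWeight w i n)) ⟩
    b * (q ^ j * ups′) + (m′ + b) * (q ^ j * wordSum i n l)
      ≈⟨ solve 5 (λ b m Q x y → b :* (Q :* x) :+ (m :+ b) :* (Q :* y) := Q :* (m :* y :+ b :* (x :+ y)))
           refl b m′ (q ^ j) ups′ (wordSum i n l) ⟩
    q ^ j * (m′ * wordSum i n l + b * (ups′ + wordSum i n l))
      ≈⟨ *-congˡ (+-congˡ (*-congˡ (sumOver-words l (λ w → stepWeight w (suc i) n)))) ⟨
    q ^ j * (m′ * wordSum i n l + b * wordSum (suc i) n (suc l))  ∎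
    where
    open ≈
    ups′ = sumOver (words l) (λ w → stepWeight (U ∷ w) (suc i) n)
    scale : ∀ y f → sumOver (words l) (λ w → y * (q ^ j * f w)) ≈ y * (q ^ j * sumOver (words l) f)
    scale y f = trans (*-distribˡ-sumOver y (words l) (λ w → q ^ j * f w))
                      (*-congˡ (*-distribˡ-sumOver (q ^ j) (words l) f))

  -- Index j stands for height j - 1.
  pathSeries : ℕ → Series
  pathSeries zero      = 1ₛ
  pathSeries (suc j) n = wordSum j n (K ℕ.* n ℕ.+ n ℕ.+ j)

  pathSeries-zero : ∀ j → pathSeries (suc j) 0 ≈ pathSeries j 0
  pathSeries-zero j = trans (suc≈1 j) (sym (≈1 j))
    where
    length≡ : ∀ j → K ℕ.* 0 ℕ.+ 0 ℕ.+ j ≡ j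
    length≡ j = ≡.cong (ℕ._+ j) (≡.trans (ℕ.+-identityʳ _) (ℕ.*-zeroʳ K))
    suc≈1 : ∀ j → pathSeries (suc j) 0 ≈ 1#
    suc≈1 j = trans (reflexive (≡.cong (wordSum j 0) (length≡ j))) (wordSum-level j)
    ≈1 : ∀ j → pathSeries j 0 ≈ 1#
    ≈1 zero    = refl
    ≈1 (suc j) = suc≈1 j

  -- Split by the first letter. A down step from height j leads to height j - 1, hence index j; an
  -- up step leads to height K + j and is resolved by `wordSum-up-suc`.
  pathSeries-suc : ∀ j n → pathSeries (suc j) (suc n) ≈
    pathSeries j (suc n) + q ^ j * (m′ * pathSeries (K ℕ.+ j) n + b * pathSeries (suc K ℕ.+ j) n)
  pathSeries-suc j n = begin
    wordSum j (suc n) (K ℕ.* suc n ℕ.+ suc n ℕ.+ j)    ≡⟨ ≡.cong (wordSum j (suc n)) (length≡ k n j) ⟩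
    wordSum j (suc n) (suc (suc l))                    ≈⟨ sumOver-words (suc l) (λ w → stepWeight w j (suc n)) ⟩
    sumOver (words (suc l)) (λ w → stepWeight (U ∷ w) j (suc n))
      + sumOver (words (suc l)) (λ w → stepWeight (D ∷ w) j (suc n))
      ≈⟨ +-comm _ _ ⟩
    _ ≈⟨ +-cong (downs≈ j (length≡ k n j)) (ups′≈ j) ⟩
    pathSeries j (suc n) + q ^ j * (m′ * pathSeries (K ℕ.+ j) n + b * wordSum (suc (k ℕ.+ j)) n (suc l))
      ≡⟨ ≡.cong (λ i → pathSeries j (suc n) + q ^ j * (m′ * pathSeries (K ℕ.+ j) n + b * wordSum (suc (k ℕ.+ j)) n i))
                (≡.sym (ℕ.+-suc (K ℕ.* n ℕ.+ n) (k ℕ.+ j))) ⟩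
    pathSeries j (suc n) + q ^ j * (m′ * pathSeries (K ℕ.+ j) n + b * pathSeries (suc K ℕ.+ j) n)  ∎
    where
    open ≈
    l = K ℕ.* n ℕ.+ n ℕ.+ (k ℕ.+ j)
    length≡ : ∀ k n j → suc k ℕ.* suc n ℕ.+ suc n ℕ.+ j ≡ suc (suc (suc k ℕ.* n ℕ.+ n ℕ.+ (k ℕ.+ j)))
    length≡ = ℕ-Solver.solve-∀
    downs≈ : ∀ j {l} → K ℕ.* suc n ℕ.+ suc n ℕ.+ j ≡ suc l →
             sumOver (words l) (λ w → stepWeight (D ∷ w) j (suc n)) ≈ pathSeries j (suc n)
    -- At height 0 no down step is allowed, which matches the vanishing of the higher coefficients
    -- of `1ₛ`.
    downs≈ zero    {l} e = sumOver-zero (words l)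
    downs≈ (suc j)     e = reflexive (≡.cong (wordSum j (suc n))
      (≡.sym (ℕ.suc-injective (≡.trans (≡.sym (ℕ.+-suc (K ℕ.* suc n ℕ.+ suc n) j)) e))))
    ups′≈ : ∀ j → _
    ups′≈ j = wordSum-up-suc j n (k ℕ.+ j) (K ℕ.* n ℕ.+ n ℕ.+ (k ℕ.+ j))

-- The expansion of χ from its functional equation.

proposition4p9 :
    {c ℓ : Level} (R : CommutativeRing c ℓ) →
    let open CommutativeRing R
        open PowerSeries R in
    (m u q [m-1]⁻¹ : Carrier) → (m - 1#) * [m-1]⁻¹ ≈ 1# →
    let open Weight R m u q using (wt*) in
    (k : ℕ) .{{_ : NonZero k}} (χ : Series) →
    1ₛ -ₛ (m - 1#) ·ₛ χ
       -ₛ p* (q ·ₛ ∏[j< k ] (λ j → χ [p q ^ j ]))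
       -ₛ p* ((q ^ 2 * (m * (u - 1#) + 1#)) ·ₛ ∏[j< suc k ] (λ j → χ [p q ^ j ]))
      ≈ₛ 0ₛ →
    χ ≈ₛ (λ n → (- q) ^ n * [m-1]⁻¹ ^ ((k ℕ.+ 1) ℕ.* n ℕ.+ 1)
                * sumOver (Dyck n k) (λ μ → wt* k μ * q ^ Area k μ))
proposition4p9 R m u q [m-1]⁻¹ inverse (suc k) χ equation n = begin
  -- χ is X₁, up to the initial factor `1ₛ` of the product and the substitution of p q⁰ for p.
  χ n                                             ≈⟨ trans (*ₛ-identityˡ (χ [p 1# ]) n) ([p1] χ n) ⟨
  qProduct q χ 1 n
    ≈⟨ expansion-from-recursion q b m′ [m-1]⁻¹ K χ inverse equation′
         pathSeries (λ _ → refl) pathSeries-zero pathSeries-suc n 1 ⟩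
  (- q) ^ n * ([m-1]⁻¹ ^ suc K) ^ n * [m-1]⁻¹ ^ 1 * pathSeries 1 n
    ≈⟨ *-cong (trans (*-assoc _ _ _) (*-congˡ exponent)) (begin
         wordSum 0 n (K ℕ.* n ℕ.+ n ℕ.+ 0)    ≡⟨ ≡.cong (wordSum 0 n) (ℕ.+-identityʳ (K ℕ.* n ℕ.+ n)) ⟩
         wordSum 0 n (K ℕ.* n ℕ.+ n)          ≈⟨ dyckSum≈wordSum n ⟨
         dyckSum n                            ∎) ⟩
  (- q) ^ n * [m-1]⁻¹ ^ ((K ℕ.+ 1) ℕ.* n ℕ.+ 1) * dyckSum n  ∎
  where
  open CommutativeRing R hiding (zero)
  open PowerSeries R
  open Weight R m u q
  open SeriesProperties R hiding (module ≈)
  open PathWeight R m u q k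
  open ≈
  open ExpProperties semiring using (^-homo-*; ^-congʳ; ^-assocʳ)

  exponent : ([m-1]⁻¹ ^ suc K) ^ n * [m-1]⁻¹ ^ 1 ≈ [m-1]⁻¹ ^ ((K ℕ.+ 1) ℕ.* n ℕ.+ 1)
  exponent = begin
    ([m-1]⁻¹ ^ suc K) ^ n * [m-1]⁻¹ ^ 1    ≈⟨ *-congʳ (^-assocʳ [m-1]⁻¹ (suc K) n) ⟩
    [m-1]⁻¹ ^ (suc K ℕ.* n) * [m-1]⁻¹ ^ 1  ≈⟨ ^-homo-* [m-1]⁻¹ (suc K ℕ.* n) 1 ⟨
    [m-1]⁻¹ ^ (suc K ℕ.* n ℕ.+ 1)          ≡⟨ ≡.cong (λ i → [m-1]⁻¹ ^ (i ℕ.* n ℕ.+ 1)) (ℕ.+-comm 1 K) ⟩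
    [m-1]⁻¹ ^ ((K ℕ.+ 1) ℕ.* n ℕ.+ 1)      ∎

  -- m (u - 1) = m′ u′ + u′
  coefficient≈ : q ^ 2 * (m * (u - 1#) + 1#) ≈ q * b
  coefficient≈ = begin
    q ^ 2 * (m * u′ + 1#)                   ≈⟨ *-cong (*-congˡ (*-identityʳ q)) (+-congʳ (begin
      m * u′                                  ≈⟨ *-congʳ (begin
        m                                       ≈⟨ +-identityʳ m ⟨
        m + 0#                                  ≈⟨ +-congˡ (-‿inverseˡ 1#) ⟨
        m + (- 1# + 1#)                         ≈⟨ +-assoc m (- 1#) 1# ⟨
        m′ + 1#                                 ∎) ⟩
      (m′ + 1#) * u′                          ≈⟨ distribʳ u′ m′ 1# ⟩
      m′ * u′ + 1# * u′                       ≈⟨ +-congˡ (*-identityˡ u′) ⟩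
      m′ * u′ + u′                            ∎)) ⟩
    q * q * (m′ * u′ + u′ + 1#)             ≈⟨ *-assoc q q _ ⟩
    q * b                                   ∎

  equation′ : 1ₛ ≈ₛ m′ ·ₛ χ +ₛ p* (q ·ₛ qProduct q χ K) +ₛ p* ((q * b) ·ₛ qProduct q χ (suc K))
  equation′ i = trans (x-y-z-t≈0 (equation i)) (+-congˡ (p*-cong (λ j → *-congʳ coefficient≈) i))
    where
    move : ∀ {x y z} → x - y ≈ z → x ≈ z + y
    move {x} {y} {z} e = begin
      x                ≈⟨ +-identityʳ x ⟨
      x + 0#           ≈⟨ +-congˡ (-‿inverseˡ y) ⟨
      x + (- y + y)    ≈⟨ +-assoc x (- y) y ⟨
      x - y + y        ≈⟨ +-congʳ e ⟩
      z + y            ∎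
    x-y-z-t≈0 : ∀ {x y z t} → x - y - z - t ≈ 0# → x ≈ y + z + t
    x-y-z-t≈0 {x} {y} {z} {t} e = begin
      x                ≈⟨ move (move (move e)) ⟩
      0# + t + z + y   ≈⟨ +-congʳ (+-congʳ (+-identityˡ t)) ⟩
      t + z + y        ≈⟨ +-comm _ y ⟩
      y + (t + z)      ≈⟨ +-congˡ (+-comm t z) ⟩
      y + (z + t)      ≈⟨ +-assoc y z t ⟨
      y + z + t        ∎
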